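{- There are graphs of order $n$ (for infinitely many $n$) that have at least $\left(\sqrt[5]{16}\right)^n\in\Omega(1.7411^n)$ many minimal Roman dominating functions.
   Context: Graphs are finite, undirected and simple; the order of a graph is its number of vertices. For a graph $G=(V,E)$, a function $f\colon V\to\{0,1,2\}$ is a Roman dominating function (rdf) if every $v$ with $f(v)=0$ has a neighbor $u$ with $f(u)=2$. $f\le g$ means $f(v)\le g(v)$ for all $v\in V$ (with $0<1<2$); an rdf $f$ is minimal if there is no rdf $g\ne f$ with $g\le f$. -}

module Defs where

open import Data.Fin.Base as Fin using (Fin)
open import Data.Fin.Patterns using (0F; 2F)
import Data.Fin.Properties as Fin
open import Data.Integer.Base using (+_)
open import Data.List.Base using (List; []; _∷_; length; filter; allFin; cartesianProductWith)
open import Data.List.Membership.Propositional using (_∈_; find; lose)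
open import Data.List.Membership.Propositional.Properties using (∈-allFin; ∈-cartesianProductWith⁺)
open import Data.List.Relation.Unary.All using ([])
open import Data.List.Relation.Unary.AllPairs using ([]; _∷_)
import Data.List.Relation.Unary.Any as Any
open import Data.List.Relation.Unary.Any using (here)
open import Data.List.Relation.Unary.Unique.Propositional using (Unique)
import Data.List.Relation.Unary.Unique.Propositional.Properties as Unique
open import Data.Nat.Base as ℕ using (ℕ; zero; suc)
open import Data.Product.Base using (∃; _×_; _,_)
open import Data.Rational.Base as ℚ using (ℚ; 0ℚ; _/_)
open import Data.Vec.Base using (Vec; []; _∷_; lookup)
open import Data.Vec.Properties using (≡-dec; ∷-injective)
open import Algebra.Definitions.RawSemiring ℚ.+-*-rawSemiring using (_^_)
open import Level using (0ℓ)
open import Relation.Binary.Core using (Rel)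
open import Relation.Binary.Definitions using (Symmetric; Irreflexive; Decidable)
open import Relation.Binary.PropositionalEquality using (_≡_; _≢_; refl)
open import Relation.Nullary.Decidable using (Dec; map′; ¬?; _×-dec_; _→-dec_)
open import Relation.Nullary.Negation using (¬_)
import Relation.Unary as Unary

record Graph (n : ℕ) : Set₁ where
  field
    Adj    : Rel (Fin n) 0ℓ
    sym    : Symmetric Adj
    irrefl : Irreflexive _≡_ Adj
    adj?   : Decidable Adj

-- A function V → {0,1,2} is stored as its vector of values, so that equality
-- of functions is propositional equality.
Labelling : ℕ → Set
Labelling n = Vec (Fin 3) n

infix 4 _≤ₗ_

_≤ₗ_ : ∀ {n} → Rel (Labelling n) 0ℓ
f ≤ₗ g = ∀ v → lookup f v Fin.≤ lookup g v

module _ {n : ℕ} (G : Graph n) where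
  open Graph G

  IsRdf : Unary.Pred (Labelling n) 0ℓ
  IsRdf f = ∀ v → lookup f v ≡ 0F → ∃ λ u → Adj v u × lookup f u ≡ 2F

  IsMinimalRdf : Unary.Pred (Labelling n) 0ℓ
  IsMinimalRdf f = IsRdf f × ¬ (∃ λ g → IsRdf g × g ≢ f × g ≤ₗ f)

labellings : ∀ n → List (Labelling n)
labellings zero    = [] ∷ []
labellings (suc n) = cartesianProductWith _∷_ (allFin 3) (labellings n)

labellings-complete : ∀ {n} (f : Labelling n) → f ∈ labellings n
labellings-complete []      = here refl
labellings-complete (x ∷ f) =
  ∈-cartesianProductWith⁺ _∷_ (∈-allFin x) (labellings-complete f)

labellings-unique : ∀ n → Unique (labellings n)
labellings-unique zero    = [] ∷ []
labellings-unique (suc n) =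
  Unique.cartesianProductWith⁺ _∷_ ∷-injective (Unique.allFin⁺ 3) (labellings-unique n)

anyLabelling? : ∀ {n} {P : Unary.Pred (Labelling n) 0ℓ} → Unary.Decidable P → Dec (∃ P)
anyLabelling? {n} P? = map′
  (λ p → let f , _ , pf = find p in f , pf)
  (λ (f , pf) → lose (labellings-complete f) pf)
  (Any.any? P? (labellings n))

module _ {n : ℕ} (G : Graph n) where
  open Graph G

  isRdf? : Unary.Decidable (IsRdf G)
  isRdf? f = Fin.all? λ v → (lookup f v Fin.≟ 0F) →-dec
    Fin.any? λ u → adj? v u ×-dec (lookup f u Fin.≟ 2F)

  isMinimalRdf? : Unary.Decidable (IsMinimalRdf G)
  isMinimalRdf? f = isRdf? f ×-dec ¬? (anyLabelling? λ g →
    isRdf? g ×-dec ¬? (≡-dec Fin._≟_ g f) ×-dec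
    Fin.all? λ v → lookup g v Fin.≤? lookup f v)

  #minimalRdfs : ℕ
  #minimalRdfs = length (filter isMinimalRdf? (labellings n))

infix 4 ⁵√16^_≤_ _≤⁵√16^_

-- Comparisons with the real number (⁵√16)ⁿ.  Since x ↦ x⁵ is strictly
-- increasing on the reals, x ≤ (⁵√16)ⁿ iff x⁵ ≤ 16ⁿ, and dually.
⁵√16^_≤_ : ℕ → ℕ → Set
⁵√16^ n ≤ m = 16 ℕ.^ n ℕ.≤ m ℕ.^ 5

_≤⁵√16^_ : ℚ → ℕ → Set
x ≤⁵√16^ n = x ^ 5 ℚ.≤ (+ 16 / 1) ^ n

-- (⁵√16)ⁿ ∈ Ω(bⁿ).  A positive real constant exists iff a positive rational
-- one does.
⁵√16ⁿ∈Ω[_ⁿ] : ℚ → Set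
⁵√16ⁿ∈Ω[ b ⁿ] = ∃ λ c → 0ℚ ℚ.< c × ∃ λ n₀ → ∀ n → n₀ ℕ.≤ n → c ℚ.* b ^ n ≤⁵√16^ n

-- The 5-cycle has exactly 16 minimal Roman dominating functions.  Roman
-- domination and minimality are checked component by component, so the counts
-- multiply over disjoint unions, and k disjoint 5-cycles have order 5k and at
-- least 16ᵏ = (⁵√16)⁵ᵏ minimal rdfs.  The growth estimate is 1.7411⁵ ≤ 16.
module Submission where

open import Defs
open import Data.Integer.Base using (+_)
open import Data.Nat.Base using (ℕ; _≤_)
open import Data.Product.Base using (Σ; ∃; _×_)
open import Data.Rational.Base using (_/_)

open import Algebra.Bundles using (CommutativeRing)
import Algebra.Properties.Semiring.Exp as Exp
open import Data.Fin.Base as Fin using (Fin; zero; suc; _↑ˡ_; _↑ʳ_)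
open import Data.Fin.Patterns using (0F; 1F; 2F; 3F; 4F)
import Data.Fin.Properties as Fin
open import Data.List.Base as List using (List; []; _∷_; length; filter; cartesianProductWith)
open import Data.List.Membership.Propositional.Properties
  using (∈-lookup; ∈-filter⁺; ∈-filter⁻; ∈-cartesianProductWith⁻)
open import Data.List.Membership.Setoid.Properties using (index-injective)
open import Data.List.Properties using (length-++; length-map)
open import Data.List.Relation.Binary.Subset.Propositional using (_⊆_)
import Data.List.Relation.Unary.All as All
open import Data.List.Relation.Unary.AllPairs using (_∷_)
import Data.List.Relation.Unary.Any as Any
open import Data.List.Relation.Unary.Unique.Propositional using (Unique)
import Data.List.Relation.Unary.Unique.Propositional.Properties as Unique
open import Data.Nat.Base as ℕ using (zero; suc; _+_; _*_; _^_)
import Data.Nat.Properties as ℕ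
open import Data.Product.Base using (_,_; proj₂)
import Data.Rational.Base as ℚ
import Data.Rational.Properties as ℚ
open import Data.Sum.Base using (_⊎_; inj₁; inj₂; swap)
open import Data.Sum.Relation.Binary.Pointwise
  using (Pointwise; inj₁; inj₂; ⊎-refl; ⊎-symmetric; ⊎-irreflexive; ⊎-decidable)
open import Data.Vec.Base using (_++_; lookup; splitAt)
open import Data.Vec.Properties using (≡-dec; lookup-splitAt; lookup-++ˡ; lookup-++ʳ; ++-injective)
open import Relation.Binary.PropositionalEquality
  using (_≡_; _≢_; refl; sym; trans; cong; cong₂; subst; subst₂; setoid)
open import Relation.Nullary.Decidable using (yes; no; from-yes; ¬?; _⊎-dec_)
open import Relation.Nullary.Negation using (¬_; contradiction)

module _ {a} {A : Set a} where

  Unique⇒lookup-injective : ∀ {xs : List A} → Unique xs →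
    ∀ {i j} → List.lookup xs i ≡ List.lookup xs j → i ≡ j
  Unique⇒lookup-injective (_ ∷ _) {zero} {zero} _ = refl
  Unique⇒lookup-injective (x∉ ∷ _) {zero} {suc j} eq =
    contradiction eq (All.lookup x∉ (∈-lookup j))
  Unique⇒lookup-injective (x∉ ∷ _) {suc i} {zero} eq =
    contradiction (sym eq) (All.lookup x∉ (∈-lookup i))
  Unique⇒lookup-injective (_ ∷ u) {suc i} {suc j} eq =
    cong suc (Unique⇒lookup-injective u eq)

  -- Send each position in `xs` to a position of the same element in `ys`. Since `xs` has no
  -- repetitions this map is injective, and the pigeonhole principle gives the bound.
  Unique-⊆⇒length-≤ : ∀ {xs ys : List A} → Unique xs → xs ⊆ ys → length xs ≤ length ys
  Unique-⊆⇒length-≤ u xs⊆ys = Fin.injective⇒≤ {f = λ i → Any.index (xs⊆ys (∈-lookup i))}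
    λ {i} {j} eq → Unique⇒lookup-injective u
      (index-injective (setoid A) (xs⊆ys (∈-lookup i)) (xs⊆ys (∈-lookup j)) eq)

length-cartesianProductWith : ∀ {a b c} {A : Set a} {B : Set b} {C : Set c}
  (f : A → B → C) (xs : List A) (ys : List B) →
  length (cartesianProductWith f xs ys) ≡ length xs * length ys
length-cartesianProductWith f []       ys = refl
length-cartesianProductWith f (x ∷ xs) ys = trans
  (length-++ (List.map (f x) ys))
  (cong₂ _+_ (length-map (f x) ys) (length-cartesianProductWith f xs ys))

infixr 5 _⊕_

-- Disjoint union. `Pointwise` has no constructor relating `inj₁` to `inj₂`, so no edge joins the
-- two parts. The vertices of `G` come first, which matches the labelling `f ++ g`.
_⊕_ : ∀ {m n} → Graph m → Graph n → Graph (m + n)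
_⊕_ {m} G H = record
  { Adj    = λ u v → Pointwise G.Adj H.Adj (Fin.splitAt m u) (Fin.splitAt m v)
  ; sym    = ⊎-symmetric G.sym H.sym
  ; irrefl = λ { refl → ⊎-irreflexive G.irrefl H.irrefl (⊎-refl refl refl) }
  ; adj?   = λ u v → ⊎-decidable G.adj? H.adj? (Fin.splitAt m u) (Fin.splitAt m v)
  }
  where
  module G = Graph G
  module H = Graph H

module _ {m n} (G : Graph m) (H : Graph n) where
  private
    module G = Graph G
    module H = Graph H

  ++-isRdf⁺ : ∀ {f g} → IsRdf G f → IsRdf H g → IsRdf (G ⊕ H) (f ++ g)
  ++-isRdf⁺ {f} {g} rf rg v fg≡0
    with Fin.splitAt m v | trans (sym (lookup-splitAt m f g v)) fg≡0
  ... | inj₁ i | f≡0 = let u , e , f≡2 = rf i f≡0 in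
    u ↑ˡ n , subst (Pointwise _ _ _) (sym (Fin.splitAt-↑ˡ m u n)) (inj₁ e) ,
    trans (lookup-++ˡ f g u) f≡2
  ... | inj₂ j | g≡0 = let u , e , g≡2 = rg j g≡0 in
    m ↑ʳ u , subst (Pointwise _ _ _) (sym (Fin.splitAt-↑ʳ m n u)) (inj₂ e) ,
    trans (lookup-++ʳ f g u) g≡2

  -- A neighbor of a left vertex is again a left vertex, so the neighbor labelled 2 is found within
  -- `G`. The mixed case is impossible and has no clause.
  ++-isRdf⁻ˡ : ∀ f g → IsRdf (G ⊕ H) (f ++ g) → IsRdf G f
  ++-isRdf⁻ˡ f g r i f≡0 with r (i ↑ˡ n) (trans (lookup-++ˡ f g i) f≡0)
  ... | u , e , fg≡2
    with Fin.splitAt m u | subst (λ s → Pointwise G.Adj H.Adj s _) (Fin.splitAt-↑ˡ m i n) e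
       | trans (sym (lookup-splitAt m f g u)) fg≡2
  ... | inj₁ j | inj₁ e′ | f≡2 = j , e′ , f≡2

  ++-isRdf⁻ʳ : ∀ f g → IsRdf (G ⊕ H) (f ++ g) → IsRdf H g
  ++-isRdf⁻ʳ f g r i g≡0 with r (m ↑ʳ i) (trans (lookup-++ʳ f g i) g≡0)
  ... | u , e , fg≡2
    with Fin.splitAt m u | subst (λ s → Pointwise G.Adj H.Adj s _) (Fin.splitAt-↑ʳ m n i) e
       | trans (sym (lookup-splitAt m f g u)) fg≡2
  ... | inj₂ j | inj₂ e′ | g≡2 = j , e′ , g≡2

  -- A competitor `h` splits as `f′ ++ g′`. If it differs from `f ++ g`, then one of its halves
  -- differs from the corresponding half, and that half alone contradicts minimality in its own
  -- graph.
  ++-isMinimalRdf : ∀ {f g} → IsMinimalRdf G f → IsMinimalRdf H g →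
                    IsMinimalRdf (G ⊕ H) (f ++ g)
  ++-isMinimalRdf {f} {g} (rf , minf) (rg , ming) = ++-isRdf⁺ {f} {g} rf rg , minimal
    where
    minimal : ¬ (∃ λ h → IsRdf (G ⊕ H) h × h ≢ f ++ g × h ≤ₗ f ++ g)
    minimal (h , rh , h≢ , h≤) with splitAt m h
    ... | f′ , g′ , refl with ≡-dec Fin._≟_ f′ f | ≡-dec Fin._≟_ g′ g
    ...   | no f′≢f  | _        = minf (f′ , ++-isRdf⁻ˡ f′ g′ rh , f′≢f , λ i →
      subst₂ Fin._≤_ (lookup-++ˡ f′ g′ i) (lookup-++ˡ f g i) (h≤ (i ↑ˡ n)))
    ...   | yes _    | no g′≢g  = ming (g′ , ++-isRdf⁻ʳ f′ g′ rh , g′≢g , λ i →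
      subst₂ Fin._≤_ (lookup-++ʳ f′ g′ i) (lookup-++ʳ f g i) (h≤ (m ↑ʳ i)))
    ...   | yes refl | yes refl = h≢ refl

  -- Concatenation at fixed lengths is injective, so distinct pairs of minimal rdfs give distinct
  -- minimal rdfs of the union.
  #minimalRdfs-⊕ : #minimalRdfs G * #minimalRdfs H ≤ #minimalRdfs (G ⊕ H)
  #minimalRdfs-⊕ = begin
    length Fs * length Gs                       ≡⟨ length-cartesianProductWith _++_ Fs Gs ⟨
    length (cartesianProductWith _++_ Fs Gs)    ≤⟨ Unique-⊆⇒length-≤ unique included ⟩
    #minimalRdfs (G ⊕ H)                        ∎
    where
    open ℕ.≤-Reasoning
    Fs : List (Labelling m)
    Fs = filter (isMinimalRdf? G) (labellings m)
    Gs : List (Labelling n)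
    Gs = filter (isMinimalRdf? H) (labellings n)

    unique : Unique (cartesianProductWith _++_ Fs Gs)
    unique = Unique.cartesianProductWith⁺ _++_ (λ {f} {f′} → ++-injective f f′)
      (Unique.filter⁺ (isMinimalRdf? G) (labellings-unique m))
      (Unique.filter⁺ (isMinimalRdf? H) (labellings-unique n))

    included : cartesianProductWith _++_ Fs Gs ⊆ filter (isMinimalRdf? (G ⊕ H)) (labellings (m + n))
    included h∈ with ∈-cartesianProductWith⁻ _++_ Fs Gs h∈
    ... | f , g , f∈ , g∈ , refl = ∈-filter⁺ (isMinimalRdf? (G ⊕ H)) (labellings-complete (f ++ g))
      (++-isMinimalRdf (proj₂ (∈-filter⁻ (isMinimalRdf? G) {xs = labellings m} f∈))
                       (proj₂ (∈-filter⁻ (isMinimalRdf? H) {xs = labellings n} g∈)))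

emptyGraph : Graph 0
emptyGraph = record
  { Adj = λ () ; sym = λ { {()} } ; irrefl = λ { {()} } ; adj? = λ () }

next : Fin 5 → Fin 5
next 0F = 1F
next 1F = 2F
next 2F = 3F
next 3F = 4F
next 4F = 0F

next-≢ : ∀ u → next u ≢ u
next-≢ = from-yes (Fin.all? λ u → ¬? (next u Fin.≟ u))

C₅ : Graph 5
C₅ = record
  { Adj    = λ u v → next u ≡ v ⊎ next v ≡ u
  ; sym    = swap
  ; irrefl = λ { {u} refl (inj₁ eq) → next-≢ u eq ; {u} refl (inj₂ eq) → next-≢ u eq }
  ; adj?   = λ u v → (next u Fin.≟ v) ⊎-dec (next v Fin.≟ u)
  }

#minimalRdfs-C₅ : #minimalRdfs C₅ ≡ 16
-- Evaluation of the decision procedure on all 243 labellings. The 16 are the constant 1 and the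
-- five rotations of each of 2,0,1,1,0 and 2,2,0,1,0 and 2,0,2,0,0.
#minimalRdfs-C₅ = refl

copies : ∀ {n} → Graph n → ∀ k → Graph (k * n)
copies G zero    = emptyGraph
copies G (suc k) = G ⊕ copies G k

#minimalRdfs-copies : ∀ {n} (G : Graph n) k → #minimalRdfs G ^ k ≤ #minimalRdfs (copies G k)
-- The empty graph has one labelling, which is vacuously a minimal rdf, so both sides compute to 1.
#minimalRdfs-copies G zero    = ℕ.≤-refl
#minimalRdfs-copies G (suc k) = ℕ.≤-trans
  (ℕ.*-monoʳ-≤ (#minimalRdfs G) (#minimalRdfs-copies G k))
  (#minimalRdfs-⊕ G (copies G k))

⁵√16^-copies-C₅ : ∀ k → ⁵√16^ (k * 5) ≤ #minimalRdfs (copies C₅ k)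
⁵√16^-copies-C₅ k = begin
  16 ^ (k * 5)                       ≡⟨ ℕ.^-*-assoc 16 k 5 ⟨
  (16 ^ k) ^ 5                       ≡⟨ cong (λ c → (c ^ k) ^ 5) #minimalRdfs-C₅ ⟨
  (#minimalRdfs C₅ ^ k) ^ 5          ≤⟨ ℕ.^-monoˡ-≤ 5 (#minimalRdfs-copies C₅ k) ⟩
  #minimalRdfs (copies C₅ k) ^ 5     ∎
  where open ℕ.≤-Reasoning

private
  -- The same power function as in the definition of `_≤⁵√16^_`, now accompanied by the exponent
  -- laws of a semiring.
  module ℚ^ = Exp (CommutativeRing.semiring ℚ.+-*-commutativeRing)

^-nonNeg : ∀ p .{{_ : ℚ.NonNegative p}} n → ℚ.NonNegative (p ℚ^.^ n)
^-nonNeg p zero    = _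
^-nonNeg p (suc n) = ℚ.nonNeg*nonNeg⇒nonNeg p (p ℚ^.^ n) {{^-nonNeg p n}}

^-monoˡ-≤-nonNeg : ∀ {p q} .{{_ : ℚ.NonNegative p}} .{{_ : ℚ.NonNegative q}} n →
                   p ℚ.≤ q → p ℚ^.^ n ℚ.≤ q ℚ^.^ n
^-monoˡ-≤-nonNeg zero p≤q = ℚ.≤-refl
^-monoˡ-≤-nonNeg {p} {q} (suc n) p≤q = ℚ.≤-trans
  (ℚ.*-monoʳ-≤-nonNeg (p ℚ^.^ n) {{^-nonNeg p n}} p≤q)
  (ℚ.*-monoˡ-≤-nonNeg q (^-monoˡ-≤-nonNeg n p≤q))

⁵√16ⁿ∈Ω[1·7411ⁿ] : ⁵√16ⁿ∈Ω[ + 17411 / 10000 ⁿ]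
-- The constant 1 and the threshold 0 suffice, because the base 1.7411 is itself at most the fifth
-- root of 16.
⁵√16ⁿ∈Ω[1·7411ⁿ] = ℚ.1ℚ , from-yes (ℚ.0ℚ ℚ.<? ℚ.1ℚ) , 0 , λ n _ → bound n
  where
  open ℚ.≤-Reasoning
  b : ℚ.ℚ
  b = + 17411 / 10000

  bound : ∀ n → ℚ.1ℚ ℚ.* b ℚ^.^ n ≤⁵√16^ n
  bound n = begin
    (ℚ.1ℚ ℚ.* b ℚ^.^ n) ℚ^.^ 5  ≡⟨ cong (ℚ^._^ 5) (ℚ.*-identityˡ (b ℚ^.^ n)) ⟩
    (b ℚ^.^ n) ℚ^.^ 5           ≡⟨ ℚ^.^-assocʳ b n 5 ⟩
    b ℚ^.^ (n * 5)              ≡⟨ cong (b ℚ^.^_) (ℕ.*-comm n 5) ⟩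
    b ℚ^.^ (5 * n)              ≡⟨ ℚ^.^-assocʳ b 5 n ⟨
    -- Exchanging the exponents leaves one numerical inequality between fifth powers, decided in
    -- exact rational arithmetic. It is tight: the fifth root of 16 is 1.741101...
    (b ℚ^.^ 5) ℚ^.^ n           ≤⟨ ^-monoˡ-≤-nonNeg n (from-yes (b ℚ^.^ 5 ℚ.≤? + 16 / 1)) ⟩
    (+ 16 / 1) ℚ^.^ n           ∎

corollary2 : (∀ (N : ℕ) → ∃ λ n → N ≤ n × Σ (Graph n) λ G → ⁵√16^ n ≤ #minimalRdfs G)
    × ⁵√16ⁿ∈Ω[ + 17411 / 10000 ⁿ]
-- Taking `N` copies gives order `N * 5`, which is at least `N`, so the orders are unbounded and
-- hence infinitely many.
corollary2 = (λ N → N * 5 , ℕ.m≤m*n N 5 , copies C₅ N , ⁵√16^-copies-C₅ N) , ⁵√16ⁿ∈Ω[1·7411ⁿ]
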